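{- Let $A$ be a finite alphabet. For every sentence $I$ over $A$, the coproduct of the fundamental coloured quasi-symmetric function $F_I$ in $\mathrm{QSym}_A$ is $$\delta(F_I)=\sum_{(K',K'')}F_{K'}\otimes F_{K''},$$ where the summation is over all pairs of sentences $(K',K'')$ which give $I$ by concatenation or by near-concatenation, i.e. such that $K'\cdot K''=I$ or $K'\odot K''=I$.
   Context: $\Bbbk$ is a field of characteristic zero. A sentence $I=(w_1,\dots,w_m)$ over $A$ is a finite sequence of non-empty words in letters of $A$; $1$ is the empty sentence. The concatenation of $I=(w_1,\dots,w_m)$ and $J=(v_1,\dots,v_n)$ is $I\cdot J=(w_1,\dots,w_m,v_1,\dots,v_n)$; for non-empty sentences $I,J$ the near-concatenation is $I\odot J=(w_1,\dots,w_{m-1},w_mv_1,v_2,\dots,v_n)$. Write $J\preccurlyeq I$ ($J$ refines $I$) if the words of $I$ can be obtained by concatenating adjacent words of $J$. $\mathrm{QSym}_A$ is the Hopf algebra over $\Bbbk$ with linear basis $(M_I)$ indexed by sentences over $A$ and coproduct $\delta(M_I)=\sum_{J\cdot K=I}M_J\otimes M_K$ (it is the graded dual of the Hopf algebra $\mathrm{NSym}_A$ with basis $(H_I)$ dual to $(M_I)$). The fundamental coloured quasi-symmetric functions are $F_I=\sum_{J\preccurlyeq I}M_J$. -}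

module Defs where

open import Level using (Level; _⊔_)
open import Algebra.Bundles using (CommutativeRing)
open import Algebra.Apartness.Bundles using (HeytingField; HeytingCommutativeRing)
open import Algebra.Module.Bundles using (Module)
open import Algebra.Module.Morphism.Structures using (module ModuleMorphisms)
open import Algebra.Module.Structures.Biased using (module IsModuleFromLeft)
open import Data.Empty using (⊥)
open import Data.Fin.Base using (Fin)
open import Data.List.Base using (List; []; _∷_; _++_; map; concat; foldr; length)
import Data.List.NonEmpty.Base as List⁺
open import Data.List.NonEmpty.Base using (List⁺; _∷_; _∷⁺_; toList; _⁺++⁺_)
open import Data.List.Membership.Propositional using (_∈_)
open import Data.List.Membership.Propositional.Properties
  using (∈-map⁺; ∈-map⁻; ∈-++⁺ˡ; ∈-++⁺ʳ; ∈-++⁻)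
open import Data.List.Properties using (∷-injective)
open import Data.List.Relation.Unary.All using (All; []; _∷_)
import Data.List.Relation.Unary.All.Properties as All
open import Data.List.Relation.Unary.Any using (here; there)
open import Data.List.Relation.Unary.AllPairs using ([]; _∷_)
open import Data.List.Relation.Unary.Unique.Propositional using (Unique)
import Data.List.Relation.Unary.Unique.Propositional.Properties as Unique
open import Data.Nat.Base using (ℕ; suc)
open import Data.Nat.Properties using (1+n≢n)
open import Data.Product.Base using (_×_; _,_; proj₁; proj₂; ∃; ∃-syntax; map₁)
open import Data.Sum.Base using (_⊎_; inj₁; inj₂)
open import Function.Base using (flip)
open import Function.Bundles using (_↔_)
open import Relation.Binary.PropositionalEquality
  using (_≡_; _≢_; refl; sym; trans; cong; cong₂)
open import Relation.Nullary.Negation using (¬_)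

Finite : ∀ {a} → Set a → Set a
Finite A = ∃[ n ] (A ↔ Fin n)

-- The stdlib has no bundle of fields with mere inequality; a Heyting field is
-- the constructive notion, and classically a field is one with _#_ = _≉_.
HeytingField⇒CommutativeRing :
  ∀ {c ℓ₁ ℓ₂} → HeytingField c ℓ₁ ℓ₂ → CommutativeRing c ℓ₁
HeytingField⇒CommutativeRing 𝕜 =
  HeytingCommutativeRing.commutativeRing (HeytingField.heytingCommutativeRing 𝕜)

CharacteristicZero : ∀ {c ℓ₁ ℓ₂} → HeytingField c ℓ₁ ℓ₂ → Set ℓ₁
CharacteristicZero 𝕜 = (n : ℕ) → ¬ (suc n ×ⁿ 1# ≈ 0#)
  where
  open CommutativeRing (HeytingField⇒CommutativeRing 𝕜)
  open import Algebra.Definitions.RawMonoid +-rawMonoid renaming (_×_ to _×ⁿ_)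

record Enumeration {x p} {X : Set x} (P : X → Set p) : Set (x ⊔ p) where
  field
    elements : List X
    unique   : Unique elements
    sound    : ∀ {x} → x ∈ elements → P x
    complete : ∀ {x} → P x → x ∈ elements

-- ∑ N e f is the sum of f x in N over all x with P x, where e enumerates P.
∑ : ∀ {c ℓ m ℓm x p} {R : CommutativeRing c ℓ} (N : Module R m ℓm)
    {X : Set x} {P : X → Set p} →
    Enumeration P → (X → Module.Carrierᴹ N) → Module.Carrierᴹ N
∑ N e f = foldr (λ x s → f x +ᴹ s) 0ᴹ (Enumeration.elements e)
  where open Module N

module _ {c ℓ : Level} (R : CommutativeRing c ℓ) where

  private
    module R = CommutativeRing R

  data Term {x} (X : Set x) : Set (c ⊔ x) where
    gen  : X → Term X
    _⊕_  : Term X → Term X → Term X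
    𝟘    : Term X
    ⊖_   : Term X → Term X
    _⊙ₛ_ : R.Carrier → Term X → Term X

  -- The least congruence containing the module axioms and the given relations.
  data Equal {x p} {X : Set x} (_~_ : Term X → Term X → Set p) :
             Term X → Term X → Set (c ⊔ ℓ ⊔ x ⊔ p) where
    relation    : ∀ {s t} → s ~ t → Equal _~_ s t
    reflexive   : ∀ {t} → Equal _~_ t t
    symmetric   : ∀ {s t} → Equal _~_ s t → Equal _~_ t s
    transitive  : ∀ {s t u} → Equal _~_ s t → Equal _~_ t u → Equal _~_ s u
    ⊕-cong      : ∀ {s s′ t t′} → Equal _~_ s s′ → Equal _~_ t t′ →
                  Equal _~_ (s ⊕ t) (s′ ⊕ t′)
    ⊖-cong      : ∀ {s s′} → Equal _~_ s s′ → Equal _~_ (⊖ s) (⊖ s′)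
    ⊙ₛ-cong     : ∀ {k k′ s s′} → k R.≈ k′ → Equal _~_ s s′ →
                  Equal _~_ (k ⊙ₛ s) (k′ ⊙ₛ s′)
    ⊕-assoc     : ∀ s t u → Equal _~_ ((s ⊕ t) ⊕ u) (s ⊕ (t ⊕ u))
    ⊕-comm      : ∀ s t → Equal _~_ (s ⊕ t) (t ⊕ s)
    ⊕-identityˡ : ∀ t → Equal _~_ (𝟘 ⊕ t) t
    ⊖-inverseˡ  : ∀ t → Equal _~_ ((⊖ t) ⊕ t) 𝟘
    ⊙ₛ-assoc    : ∀ k l t → Equal _~_ ((k R.* l) ⊙ₛ t) (k ⊙ₛ (l ⊙ₛ t))
    ⊙ₛ-identity : ∀ t → Equal _~_ (R.1# ⊙ₛ t) t
    ⊙ₛ-zeroˡ    : ∀ t → Equal _~_ (R.0# ⊙ₛ t) 𝟘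
    ⊙ₛ-zeroʳ    : ∀ k → Equal _~_ (k ⊙ₛ 𝟘) 𝟘
    ⊙ₛ-distribˡ : ∀ k s t → Equal _~_ (k ⊙ₛ (s ⊕ t)) ((k ⊙ₛ s) ⊕ (k ⊙ₛ t))
    ⊙ₛ-distribʳ : ∀ t k l → Equal _~_ ((k R.+ l) ⊙ₛ t) ((k ⊙ₛ t) ⊕ (l ⊙ₛ t))

  Presented : ∀ {x p} (X : Set x) → (Term X → Term X → Set p) →
              Module R (c ⊔ x) (c ⊔ ℓ ⊔ x ⊔ p)
  Presented X _~_ = record
    { Carrierᴹ = Term X
    ; _≈ᴹ_     = Equal _~_
    ; _+ᴹ_     = _⊕_
    ; _*ₗ_     = _⊙ₛ_
    ; _*ᵣ_     = flip _⊙ₛ_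
    ; 0ᴹ       = 𝟘
    ; -ᴹ_      = ⊖_
    ; isModule = IsModuleFromLeft.isModule {commutativeRing = R} (record
      { isLeftModule = record
        { isLeftSemimodule = record
          { +ᴹ-isCommutativeMonoid = record
            { isMonoid = record
              { isSemigroup = record
                { isMagma = record
                  { isEquivalence = record
                    { refl = reflexive ; sym = symmetric ; trans = transitive }
                  ; ∙-cong = ⊕-cong
                  }
                ; assoc = ⊕-assoc
                }
              ; identity = ⊕-identityˡ
                         , λ t → transitive (⊕-comm t 𝟘) (⊕-identityˡ t)
              }
            ; comm = ⊕-comm
            }
          ; isPreleftSemimodule = record
            { *ₗ-cong      = ⊙ₛ-cong
            ; *ₗ-zeroˡ     = ⊙ₛ-zeroˡ
            ; *ₗ-distribʳ  = ⊙ₛ-distribʳ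
            ; *ₗ-identityˡ = ⊙ₛ-identity
            ; *ₗ-assoc     = ⊙ₛ-assoc
            ; *ₗ-zeroʳ     = ⊙ₛ-zeroʳ
            ; *ₗ-distribˡ  = ⊙ₛ-distribˡ
            }
          }
        ; -ᴹ‿cong    = ⊖-cong
        ; -ᴹ‿inverse = ⊖-inverseˡ
                     , λ t → transitive (⊕-comm t (⊖ t)) (⊖-inverseˡ t)
        }
      })
    }

  -- Free X is the module with basis gen x, for x : X.
  Free : ∀ {x} (X : Set x) → Module R (c ⊔ x) (c ⊔ ℓ ⊔ x)
  Free X = Presented X (λ _ _ → ⊥)

  module _ {x m ℓm} {X : Set x} (N : Module R m ℓm) where
    open Module N

    linearExtension : (X → Carrierᴹ) → Term X → Carrierᴹ
    linearExtension f (gen x)  = f x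
    linearExtension f (s ⊕ t)  = linearExtension f s +ᴹ linearExtension f t
    linearExtension f 𝟘        = 0ᴹ
    linearExtension f (⊖ t)    = -ᴹ linearExtension f t
    linearExtension f (k ⊙ₛ t) = k *ₗ linearExtension f t

    linearExtension-cong : ∀ f {s t} → Module._≈ᴹ_ (Free X) s t →
                           linearExtension f s ≈ᴹ linearExtension f t
    linearExtension-cong f reflexive           = ≈ᴹ-refl
    linearExtension-cong f (symmetric p)       = ≈ᴹ-sym (linearExtension-cong f p)
    linearExtension-cong f (transitive p q)    =
      ≈ᴹ-trans (linearExtension-cong f p) (linearExtension-cong f q)
    linearExtension-cong f (⊕-cong p q)        =
      +ᴹ-cong (linearExtension-cong f p) (linearExtension-cong f q)
    linearExtension-cong f (⊖-cong p)          = -ᴹ‿cong (linearExtension-cong f p)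
    linearExtension-cong f (⊙ₛ-cong k p)       = *ₗ-cong k (linearExtension-cong f p)
    linearExtension-cong f (⊕-assoc s t u)     = +ᴹ-assoc _ _ _
    linearExtension-cong f (⊕-comm s t)        = +ᴹ-comm _ _
    linearExtension-cong f (⊕-identityˡ t)     = +ᴹ-identityˡ _
    linearExtension-cong f (⊖-inverseˡ t)      = -ᴹ‿inverseˡ _
    linearExtension-cong f (⊙ₛ-assoc k l t)    = *ₗ-assoc k l _
    linearExtension-cong f (⊙ₛ-identity t)     = *ₗ-identityˡ _
    linearExtension-cong f (⊙ₛ-zeroˡ t)        = *ₗ-zeroˡ _
    linearExtension-cong f (⊙ₛ-zeroʳ k)        = *ₗ-zeroʳ k
    linearExtension-cong f (⊙ₛ-distribˡ k s t) = *ₗ-distribˡ k _ _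
    linearExtension-cong f (⊙ₛ-distribʳ t k l) = *ₗ-distribʳ _ k l

    linearExtension-isModuleHomomorphism : ∀ f →
      ModuleMorphisms.IsModuleHomomorphism
        (Module.rawModule (Free X)) rawModule (linearExtension f)
    linearExtension-isModuleHomomorphism f = record
      { isBimoduleHomomorphism = record
        { +ᴹ-isGroupHomomorphism = record
          { isMonoidHomomorphism = record
            { isMagmaHomomorphism = record
              { isRelHomomorphism = record { cong = linearExtension-cong f }
              ; homo = λ _ _ → ≈ᴹ-refl
              }
            ; ε-homo = ≈ᴹ-refl
            }
          ; ⁻¹-homo = λ _ → ≈ᴹ-refl
          }
        ; *ₗ-homo = λ _ _ → ≈ᴹ-refl
        ; *ᵣ-homo = λ k t → *ₗ-*ᵣ-coincident k (linearExtension f t)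
        }
      }

  module _ {m₁ ℓm₁ m₂ ℓm₂} (V : Module R m₁ ℓm₁) (W : Module R m₂ ℓm₂) where

    private
      module V = Module V
      module W = Module W

    data Bilinearity : Term (V.Carrierᴹ × W.Carrierᴹ) →
                       Term (V.Carrierᴹ × W.Carrierᴹ) →
                       Set (c ⊔ m₁ ⊔ ℓm₁ ⊔ m₂ ⊔ ℓm₂) where
      ⊗-cong : ∀ {v v′ w w′} → v V.≈ᴹ v′ → w W.≈ᴹ w′ →
               Bilinearity (gen (v , w)) (gen (v′ , w′))
      +-⊗    : ∀ v v′ w →
               Bilinearity (gen (v V.+ᴹ v′ , w)) (gen (v , w) ⊕ gen (v′ , w))
      ⊗-+    : ∀ v w w′ →
               Bilinearity (gen (v , w W.+ᴹ w′)) (gen (v , w) ⊕ gen (v , w′))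
      *-⊗    : ∀ k v w →
               Bilinearity (gen (k V.*ₗ v , w)) (k ⊙ₛ gen (v , w))
      ⊗-*    : ∀ k v w →
               Bilinearity (gen (v , k W.*ₗ w)) (k ⊙ₛ gen (v , w))

    TensorProduct : Module R (c ⊔ m₁ ⊔ m₂) (c ⊔ ℓ ⊔ m₁ ⊔ ℓm₁ ⊔ m₂ ⊔ ℓm₂)
    TensorProduct = Presented (V.Carrierᴹ × W.Carrierᴹ) Bilinearity

Word : ∀ {a} → Set a → Set a
Word A = List⁺ A

-- The concatenation I · J is I ++ J.
Sentence : ∀ {a} → Set a → Set a
Sentence A = List (Word A)

module _ {a} {A : Set a} where

  infixr 5 _⊙_
  infix 4 _≼_

  _⊙_ : List⁺ (Word A) → List⁺ (Word A) → List⁺ (Word A)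
  (w ∷ I) ⊙ (v ∷ J) = go w I
    where
    go : Word A → Sentence A → List⁺ (Word A)
    go w []       = (w ⁺++⁺ v) ∷ J
    go w (w′ ∷ I) = w ∷⁺ go w′ I

  IsConcatenation : Sentence A → Sentence A × Sentence A → Set a
  IsConcatenation I (J , K) = J ++ K ≡ I

  IsNearConcatenation : Sentence A → Sentence A × Sentence A → Set a
  IsNearConcatenation I (J , K) =
    ∃[ J⁺ ] ∃[ K⁺ ] (toList J⁺ ≡ J × toList K⁺ ≡ K × toList (J⁺ ⊙ K⁺) ≡ I)

  -- J refines I: cut J into non-empty blocks of adjacent words; concatenating
  -- the words inside each block yields the words of I.
  _≼_ : Sentence A → Sentence A → Set a
  J ≼ I = ∃[ blocks ] (concat (map toList blocks) ≡ J × map List⁺.concat blocks ≡ I)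

  concatPairs : Sentence A → List (Sentence A × Sentence A)
  concatPairs []      = ([] , []) ∷ []
  concatPairs (w ∷ I) = ([] , w ∷ I) ∷ map (map₁ (w ∷_)) (concatPairs I)

  concatPairs-sound : ∀ I {p} → p ∈ concatPairs I → IsConcatenation I p
  concatPairs-sound []      (here refl) = refl
  concatPairs-sound (w ∷ I) (here refl) = refl
  concatPairs-sound (w ∷ I) (there p∈)
    with (_ , p∈′ , refl) ← ∈-map⁻ (map₁ (w ∷_)) p∈ =
    cong (w ∷_) (concatPairs-sound I p∈′)

  concatPairs-complete : ∀ J K → (J , K) ∈ concatPairs (J ++ K)
  concatPairs-complete []      []      = here refl
  concatPairs-complete []      (v ∷ K) = here refl
  concatPairs-complete (w ∷ J) K       =
    there (∈-map⁺ (map₁ (w ∷_)) (concatPairs-complete J K))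

  map₁-injective : {f : Sentence A → Sentence A} →
    (∀ {J K} → f J ≡ f K → J ≡ K) →
    {p q : Sentence A × Sentence A} → map₁ f p ≡ map₁ f q → p ≡ q
  map₁-injective inj eq = cong₂ _,_ (inj (cong proj₁ eq)) (cong proj₂ eq)

  ∉-map : ∀ {b c} {B : Set b} {C : Set c} {f : B → C} {y : C} →
    (∀ x → y ≢ f x) → ∀ xs → All (y ≢_) (map f xs)
  ∉-map y≢ xs = All.map⁺ (go xs)
    where
    go : ∀ xs → All (λ x → _ ≢ _) xs
    go []       = []
    go (x ∷ xs) = y≢ x ∷ go xs

  concatPairs-unique : ∀ I → Unique (concatPairs I)
  concatPairs-unique []      = [] ∷ []
  concatPairs-unique (w ∷ I) =
    ∉-map (λ _ ()) (concatPairs I) ∷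
    Unique.map⁺ (map₁-injective (λ eq → proj₂ (∷-injective eq)))
      (concatPairs-unique I)

  deconcatenations : (I : Sentence A) → Enumeration (IsConcatenation I)
  deconcatenations I = record
    { elements = concatPairs I
    ; unique   = concatPairs-unique I
    ; sound    = concatPairs-sound I
    ; complete = λ { {J , K} refl → concatPairs-complete J K }
    }

  -- Prepends a letter to the first word; the value at [] is irrelevant, and
  -- chosen to make glue a injective.
  glue : A → Sentence A → Sentence A
  glue a []      = []
  glue a (w ∷ I) = (a ∷⁺ w) ∷ I

  glue-injective : ∀ a {J K} → glue a J ≡ glue a K → J ≡ K
  glue-injective a {[]}          {[]}          refl = refl
  glue-injective a {(_ ∷ _) ∷ _} {(_ ∷ _) ∷ _} refl = refl

  single≢glue : ∀ a {J} K → (a ∷ []) ∷ J ≢ glue a K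
  single≢glue a []            ()
  single≢glue a ((_ ∷ _) ∷ _) ()

  -- If R lists the refinements of I, this lists those of (a ∷ w) ∷ I.
  refineCons : A → List A → List (Sentence A) → List (Sentence A)
  refineCons a []      R = map ((a ∷ []) ∷_) R
  refineCons a (b ∷ w) R =
    map ((a ∷ []) ∷_) (refineCons b w R) ++ map (glue a) (refineCons b w R)

  refinementList : Sentence A → List (Sentence A)
  refinementList []            = [] ∷ []
  refinementList ((a ∷ w) ∷ I) = refineCons a w (refinementList I)

  refineCons-sound : ∀ a w I R → (∀ {J} → J ∈ R → J ≼ I) →
    ∀ {J} → J ∈ refineCons a w R → J ≼ (a ∷ w) ∷ I
  refineCons-sound a [] I R R-sound J∈
    with (_ , J′∈ , refl) ← ∈-map⁻ ((a ∷ []) ∷_) J∈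
    with (Bs , refl , refl) ← R-sound J′∈ =
    (((a ∷ []) ∷ []) ∷ Bs) , refl , refl
  refineCons-sound a (b ∷ w) I R R-sound J∈
    with ∈-++⁻ (map ((a ∷ []) ∷_) (refineCons b w R)) J∈
  ... | inj₁ J∈₁
    with (_ , J′∈ , refl) ← ∈-map⁻ ((a ∷ []) ∷_) J∈₁
    with refineCons-sound b w I R R-sound J′∈
  ... | ((B ∷ Bs) ∷ Bss) , refl , refl =
    (((a ∷ []) ∷ B ∷ Bs) ∷ Bss) , refl , refl
  refineCons-sound a (b ∷ w) I R R-sound J∈ | inj₂ J∈₂
    with (_ , J′∈ , refl) ← ∈-map⁻ (glue a) J∈₂
    with refineCons-sound b w I R R-sound J′∈
  ... | ((B ∷ Bs) ∷ Bss) , refl , refl =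
    (((a ∷⁺ B) ∷ Bs) ∷ Bss) , refl , refl

  refinementList-sound : ∀ I {J} → J ∈ refinementList I → J ≼ I
  refinementList-sound []            (here refl) = [] , refl , refl
  refinementList-sound ((a ∷ w) ∷ I) J∈ =
    refineCons-sound a w I (refinementList I) (refinementList-sound I) J∈

  refineCons-complete : ∀ c cs (Bs : Sentence A) {J R} → J ∈ R →
    (((c ∷ cs) ∷ Bs) ++ J) ∈ refineCons c (cs ++ concat (map toList Bs)) R
  refineCons-complete c []        []              J∈ = ∈-map⁺ ((c ∷ []) ∷_) J∈
  refineCons-complete c []        ((b ∷ bs) ∷ Bs) J∈ =
    ∈-++⁺ˡ (∈-map⁺ ((c ∷ []) ∷_) (refineCons-complete b bs Bs J∈))
  refineCons-complete c (c′ ∷ cs) Bs              J∈ =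
    ∈-++⁺ʳ _ (∈-map⁺ (glue c) (refineCons-complete c′ cs Bs J∈))

  refinementList-complete : ∀ blocks →
    concat (map toList blocks) ∈ refinementList (map List⁺.concat blocks)
  refinementList-complete []                            = here refl
  refinementList-complete (((c ∷ cs) ∷ Bs) ∷ blocks) =
    refineCons-complete c cs Bs (refinementList-complete blocks)

  refineCons-unique : ∀ a w {R} → Unique R → Unique (refineCons a w R)
  refineCons-unique a []      R! = Unique.map⁺ (λ eq → proj₂ (∷-injective eq)) R!
  refineCons-unique a (b ∷ w) {R} R! =
    Unique.++⁺
      (Unique.map⁺ (λ eq → proj₂ (∷-injective eq)) (refineCons-unique b w R!))
      (Unique.map⁺ (glue-injective a) (refineCons-unique b w R!))
      disjoint
    where
    disjoint : ∀ {J} → J ∈ map ((a ∷ []) ∷_) (refineCons b w R) ×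
                       J ∈ map (glue a) (refineCons b w R) → ⊥
    disjoint (J∈₁ , J∈₂)
      with (_ , _ , eq₁) ← ∈-map⁻ ((a ∷ []) ∷_) J∈₁
      with (K , _ , eq₂) ← ∈-map⁻ (glue a) J∈₂ =
      single≢glue a K (trans (sym eq₁) eq₂)

  refinementList-unique : ∀ I → Unique (refinementList I)
  refinementList-unique []            = [] ∷ []
  refinementList-unique ((a ∷ w) ∷ I) =
    refineCons-unique a w (refinementList-unique I)

  refinements : (I : Sentence A) → Enumeration (_≼ I)
  refinements I = record
    { elements = refinementList I
    ; unique   = refinementList-unique I
    ; sound    = refinementList-sound I
    ; complete = λ { (blocks , refl , refl) → refinementList-complete blocks }
    }

  -- If R lists the pairs (J , K) with J ⊙ K = I, this lists those with
  -- J ⊙ K = (a ∷ w) ∷ I.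
  nearCons : A → List A → Sentence A →
             List (Sentence A × Sentence A) → List (Sentence A × Sentence A)
  nearCons a []      I R = map (map₁ ((a ∷ []) ∷_)) R
  nearCons a (b ∷ w) I R =
    ((a ∷ []) ∷ [] , (b ∷ w) ∷ I) ∷ map (map₁ (glue a)) (nearCons b w I R)

  nearPairs : Sentence A → List (Sentence A × Sentence A)
  nearPairs []            = []
  nearPairs ((a ∷ w) ∷ I) = nearCons a w I (nearPairs I)

  nearCons-sound : ∀ a w I R → (∀ {p} → p ∈ R → IsNearConcatenation I p) →
    ∀ {p} → p ∈ nearCons a w I R → IsNearConcatenation ((a ∷ w) ∷ I) p
  nearCons-sound a [] I R R-sound p∈
    with (_ , p′∈ , refl) ← ∈-map⁻ (map₁ ((a ∷ []) ∷_)) p∈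
    with ((v ∷ J) , (u ∷ K) , refl , refl , refl) ← R-sound p′∈ =
    ((a ∷ []) ∷ v ∷ J) , (u ∷ K) , refl , refl , refl
  nearCons-sound a (b ∷ w) I R R-sound (here refl) =
    ((a ∷ []) ∷ []) , ((b ∷ w) ∷ I) , refl , refl , refl
  nearCons-sound a (b ∷ w) I R R-sound (there p∈)
    with (_ , p′∈ , refl) ← ∈-map⁻ (map₁ (glue a)) p∈
    with nearCons-sound b w I R R-sound p′∈
  ... | (v ∷ [])     , (u ∷ K) , refl , refl , refl =
    ((a ∷⁺ v) ∷ []) , (u ∷ K) , refl , refl , refl
  ... | (v ∷ v′ ∷ J) , (u ∷ K) , refl , refl , refl =
    ((a ∷⁺ v) ∷ v′ ∷ J) , (u ∷ K) , refl , refl , refl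

  nearPairs-sound : ∀ I {p} → p ∈ nearPairs I → IsNearConcatenation I p
  nearPairs-sound ((a ∷ w) ∷ I) p∈ =
    nearCons-sound a w I (nearPairs I) (nearPairs-sound I) p∈

  nearPairs-complete : ∀ J K → (toList J , toList K) ∈ nearPairs (toList (J ⊙ K))
  nearPairs-complete (w ∷ J) ((u ∷ us) ∷ K) = go w J
    where
    split : ∀ a w R →
      ((a ∷ w) ∷ [] , (u ∷ us) ∷ K) ∈ nearCons a (w ++ u ∷ us) K R
    split a []      R = here refl
    split a (b ∷ w) R = there (∈-map⁺ (map₁ (glue a)) (split b w R))

    skip : ∀ a w I {x y R} → (x , y) ∈ R → ((a ∷ w) ∷ x , y) ∈ nearCons a w I R
    skip a []      I p∈ = ∈-map⁺ (map₁ ((a ∷ []) ∷_)) p∈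
    skip a (b ∷ w) I p∈ = there (∈-map⁺ (map₁ (glue a)) (skip b w I p∈))

    go : ∀ w J → (w ∷ J , (u ∷ us) ∷ K) ∈
                 nearPairs (toList ((w ∷ J) ⊙ ((u ∷ us) ∷ K)))
    go (a ∷ w) []      = split a w (nearPairs K)
    go (a ∷ w) (v ∷ J) = skip a w _ (go v J)

  nearCons-unique : ∀ a w I {R} → Unique R → Unique (nearCons a w I R)
  nearCons-unique a []      I R! =
    Unique.map⁺ (map₁-injective (λ eq → proj₂ (∷-injective eq))) R!
  nearCons-unique a (b ∷ w) I {R} R! =
    ∉-map (λ p eq → single≢glue a (proj₁ p) (cong proj₁ eq)) (nearCons b w I R) ∷
    Unique.map⁺ (map₁-injective (glue-injective a)) (nearCons-unique b w I R!)

  nearPairs-unique : ∀ I → Unique (nearPairs I)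
  nearPairs-unique []            = []
  nearPairs-unique ((a ∷ w) ∷ I) = nearCons-unique a w I (nearPairs-unique I)

  ++≢⊙ : ∀ J K → toList J ++ toList K ≢ toList (J ⊙ K)
  ++≢⊙ (w ∷ J) (u ∷ K) = go w J
    where
    go : ∀ w J → (w ∷ J) ++ u ∷ K ≢ toList ((w ∷ J) ⊙ (u ∷ K))
    go w []       eq = 1+n≢n (cong length (proj₂ (∷-injective eq)))
    go w (w′ ∷ J) eq = go w′ J (proj₂ (∷-injective eq))

  concatenation-or-near : (I : Sentence A) →
    Enumeration (λ p → IsConcatenation I p ⊎ IsNearConcatenation I p)
  concatenation-or-near I = record
    { elements = concatPairs I ++ nearPairs I
    ; unique   = Unique.++⁺ (concatPairs-unique I) (nearPairs-unique I) disjoint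
    ; sound    = λ p∈ → sound (∈-++⁻ (concatPairs I) p∈)
    ; complete = λ
        { {J , K} (inj₁ refl) → ∈-++⁺ˡ (concatPairs-complete J K)
        ; (inj₂ (J , K , refl , refl , refl)) →
            ∈-++⁺ʳ (concatPairs I) (nearPairs-complete J K)
        }
    }
    where
    disjoint : ∀ {p} → p ∈ concatPairs I × p ∈ nearPairs I → ⊥
    disjoint (p∈₁ , p∈₂)
      with (J , K , refl , refl , eq) ← nearPairs-sound I p∈₂ =
      ++≢⊙ J K (trans (concatPairs-sound I p∈₁) (sym eq))

    sound : ∀ {p} → p ∈ concatPairs I ⊎ p ∈ nearPairs I →
            IsConcatenation I p ⊎ IsNearConcatenation I p
    sound (inj₁ p∈) = inj₁ (concatPairs-sound I p∈)
    sound (inj₂ p∈) = inj₂ (nearPairs-sound I p∈)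

-- Only the coalgebra structure of QSym is defined: the product and the antipode
-- play no role for δ.
module ColouredQSym {c ℓ₁ ℓ₂ a} (𝕜 : HeytingField c ℓ₁ ℓ₂) (A : Set a) where

  private
    R : CommutativeRing c ℓ₁
    R = HeytingField⇒CommutativeRing 𝕜

  QSym : Module R (c ⊔ a) (c ⊔ ℓ₁ ⊔ a)
  QSym = Free R (Sentence A)

  QSym⊗QSym : Module R (c ⊔ a) (c ⊔ ℓ₁ ⊔ a)
  QSym⊗QSym = TensorProduct R QSym QSym

  infix 8 _⊗_

  _⊗_ : Module.Carrierᴹ QSym → Module.Carrierᴹ QSym → Module.Carrierᴹ QSym⊗QSym
  f ⊗ g = gen (f , g)

  M : Sentence A → Module.Carrierᴹ QSym
  M I = gen I

  δ : Module.Carrierᴹ QSym → Module.Carrierᴹ QSym⊗QSym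
  δ = linearExtension R QSym⊗QSym
        (λ I → ∑ QSym⊗QSym (deconcatenations I) (λ (J , K) → M J ⊗ M K))

  F : Sentence A → Module.Carrierᴹ QSym
  F I = ∑ QSym (refinements I) M

  infix 4 _≈_

  _≈_ : Module.Carrierᴹ QSym⊗QSym → Module.Carrierᴹ QSym⊗QSym → Set (c ⊔ ℓ₁ ⊔ a)
  _≈_ = Module._≈ᴹ_ QSym⊗QSym

{-# OPTIONS --safe #-}

-- Both sides are sums, of M J′ ⊗ M J″, over lists of pairs of sentences, so by
-- linearity of δ and bilinearity of ⊗ it suffices to compare these lists under
-- summation of an arbitrary function g into a commutative monoid.  The pairs
-- with J′ empty agree at once: they are the ([] , J) with J refining I.  The
-- others agree by induction on the first word of I: passing from (b ∷ w) ∷ I to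
-- (a ∷ b ∷ w) ∷ I adds, on both sides, the pairs ([a] , J) with J refining
-- (b ∷ w) ∷ I, and replaces each J′ by the two sentences got by putting a before
-- it as a new word or as a new letter.

module Submission where

open import Defs
open import Algebra.Apartness.Bundles using (HeytingField)
open import Algebra.Bundles using (CommutativeMonoid; CommutativeRing)
import Algebra.Properties.CommutativeSemigroup as CommutativeSemigroupProperties
open import Algebra.Module.Bundles using (Module)
open import Data.List.Base using (List; []; _∷_; _++_; map; foldr)
open import Data.List.Membership.Propositional using (_∈_)
open import Data.List.Membership.Propositional.Properties using (∈-map⁻; ∈-++⁻)
open import Data.List.NonEmpty.Base using (_∷_)
open import Data.List.Properties using (map-∘; map-++; foldr-map)
open import Data.List.Relation.Unary.Any using (here; there)
open import Data.Product.Base using (_×_; _,_; proj₁; map₁)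
open import Data.Sum.Base using (inj₁; inj₂)
open import Function.Base using (_∘_)
open import Relation.Binary.PropositionalEquality as ≡ using (_≡_; _≢_; refl)
import Relation.Binary.Reasoning.Setoid as SetoidReasoning
open import Relation.Nullary.Negation using (contradiction)

-- Pairs whose first sentence is non-empty.

module _ {a} {A : Set a} where

  -- The pair `([] , I)` is split off because `glue x` fixes `[]`: a letter can be glued only to a
  -- non-empty first component.
  nonEmptyConcatPairs : Sentence A → List (Sentence A × Sentence A)
  nonEmptyConcatPairs []      = []
  nonEmptyConcatPairs (w ∷ I) = map (map₁ (w ∷_)) (concatPairs I)

  concatPairs≡ : (I : Sentence A) → concatPairs I ≡ ([] , I) ∷ nonEmptyConcatPairs I
  concatPairs≡ []      = refl
  concatPairs≡ (w ∷ I) = refl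

  -- A non-empty prefix contains the first word, so a letter put before the sentence is put before
  -- the prefix.
  nonEmptyConcatPairs-glue : ∀ x (I : Sentence A) →
    nonEmptyConcatPairs (glue x I) ≡ map (map₁ (glue x)) (nonEmptyConcatPairs I)
  nonEmptyConcatPairs-glue x []      = refl
  nonEmptyConcatPairs-glue x (w ∷ I) = map-∘ (concatPairs I)

  -- Near-concatenation joins non-empty sentences only, so all of `nearPairs` is kept.
  nonEmptyPairs : Sentence A → List (Sentence A × Sentence A)
  nonEmptyPairs I = nonEmptyConcatPairs I ++ nearPairs I

  -- Supplies the hypothesis `K ≢ []` of `sum-refinementList-glue`.
  nonEmptyPairs-nonEmpty : ∀ (I : Sentence A) {p} → p ∈ nonEmptyPairs I → proj₁ p ≢ []
  nonEmptyPairs-nonEmpty I p∈ eq with ∈-++⁻ (nonEmptyConcatPairs I) p∈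
  nonEmptyPairs-nonEmpty (w ∷ I) p∈ eq | inj₁ p∈₁
    with (_ , _ , refl) ← ∈-map⁻ (map₁ (w ∷_)) p∈₁
    with () ← eq
  ... | inj₂ p∈₂
    with ((_ ∷ _) , _ , refl , _ , _) ← nearPairs-sound I p∈₂
    with () ← eq

-- Finite sums in a commutative monoid.

module Summation {c ℓ} (N : CommutativeMonoid c ℓ) where
  open CommutativeMonoid N renaming (refl to ≈-refl; reflexive to ≈-reflexive)
  open CommutativeSemigroupProperties commutativeSemigroup using (interchange; x∙yz≈y∙xz)
  open SetoidReasoning setoid

  sum : ∀ {x} {X : Set x} → (X → Carrier) → List X → Carrier
  sum f = foldr (λ x s → f x ∙ s) ε

  module _ {x} {X : Set x} where

    sum-cong : ∀ {f g : X → Carrier} xs → (∀ {x} → x ∈ xs → f x ≈ g x) →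
      sum f xs ≈ sum g xs
    sum-cong []       f≈g = ≈-refl
    sum-cong (x ∷ xs) f≈g = ∙-cong (f≈g (here refl)) (sum-cong xs (f≈g ∘ there))

    sum-++ : ∀ (f : X → Carrier) xs ys → sum f (xs ++ ys) ≈ sum f xs ∙ sum f ys
    sum-++ f []       ys = sym (identityˡ _)
    sum-++ f (x ∷ xs) ys = trans (∙-congˡ (sum-++ f xs ys)) (sym (assoc _ _ _))

    sum-∙ : ∀ (f g : X → Carrier) xs → sum (λ x → f x ∙ g x) xs ≈ sum f xs ∙ sum g xs
    sum-∙ f g []       = sym (identityˡ ε)
    sum-∙ f g (x ∷ xs) = trans (∙-congˡ (sum-∙ f g xs)) (interchange _ _ _ _)

    sum-map : ∀ {y} {Y : Set y} (f : X → Carrier) (h : Y → X) ys →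
      sum f (map h ys) ≈ sum (f ∘ h) ys
    sum-map f h ys = ≈-reflexive (foldr-map _ h ε ys)

  -- Sums over refinements and decompositions of a sentence.

  module _ {a} {A : Set a} where

    Pair : Set a
    Pair = Sentence A × Sentence A

    -- When `g` is the tensor product of basis elements, this is the expansion of `F K ⊗ F L`.
    refinementSum : (Pair → Carrier) → Pair → Carrier
    refinementSum g (K , L) =
      sum (λ J → sum (λ J′ → g (J , J′)) (refinementList L)) (refinementList K)

    refinementSum-single∷ : ∀ x g p →
      refinementSum g (map₁ ((x ∷ []) ∷_) p) ≈ refinementSum (g ∘ map₁ ((x ∷ []) ∷_)) p
    refinementSum-single∷ x g (K , L) = sum-map _ _ (refinementList K)

    -- In a refinement, the new letter is either a word of its own or part of the next letter's
    -- word. For `K = []` there is no next letter, and the right side would have an extra term.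
    sum-refinementList-glue : ∀ x (f : Sentence A → Carrier) {K} → K ≢ [] →
      sum f (refinementList (glue x K)) ≈
      sum (f ∘ ((x ∷ []) ∷_)) (refinementList K) ∙ sum (f ∘ glue x) (refinementList K)
    sum-refinementList-glue x f {[]}          K≢[] = contradiction refl K≢[]
    sum-refinementList-glue x f {(b ∷ w) ∷ K} _    =
      trans (sum-++ f (map _ Rs) _) (∙-cong (sum-map f _ Rs) (sum-map f _ Rs))
      where Rs = refineCons b w (refinementList K)

    -- `g` is quantified inside because the induction replaces it by its composites with maps
    -- altering the first component.
    DecompositionSums : Sentence A → Set _
    DecompositionSums I = ∀ (g : Pair → Carrier) →
      sum (sum g ∘ concatPairs) (refinementList I) ≈
      sum (refinementSum g) (concatPairs I ++ nearPairs I)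

    NonEmptyDecompositionSums : Sentence A → Set _
    NonEmptyDecompositionSums I = ∀ (g : Pair → Carrier) →
      sum (sum g ∘ nonEmptyConcatPairs) (refinementList I) ≈
      sum (refinementSum g) (nonEmptyPairs I)

    sum-concatPairs : ∀ (g : Pair → Carrier) Js →
      sum (sum g ∘ concatPairs) Js ≈
      sum (λ J → g ([] , J)) Js ∙ sum (sum g ∘ nonEmptyConcatPairs) Js
    sum-concatPairs g Js = trans
      (sum-cong Js λ {J} _ → ≈-reflexive (≡.cong (sum g) (concatPairs≡ J)))
      (sum-∙ _ _ Js)

    decompositionSums : ∀ I → NonEmptyDecompositionSums I → DecompositionSums I
    decompositionSums I ih g = begin
      sum (sum g ∘ concatPairs) (refinementList I)
        ≈⟨ sum-concatPairs g (refinementList I) ⟩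
      sum (λ J → g ([] , J)) (refinementList I) ∙
        sum (sum g ∘ nonEmptyConcatPairs) (refinementList I)
        -- The only refinement of `[]` is `[]`, so the outer sum at `([] , I)` has one term,
        -- followed by `ε`.
        ≈⟨ ∙-cong (sym (identityʳ _)) (ih g) ⟩
      sum (refinementSum g) (([] , I) ∷ nonEmptyPairs I)
        ≡⟨ ≡.cong (λ ps → sum (refinementSum g) (ps ++ nearPairs I)) (concatPairs≡ I) ⟨
      sum (refinementSum g) (concatPairs I ++ nearPairs I) ∎

    -- The one new pair comes from cutting the first word right after `x`; every other pair has `x`
    -- glued to its first component.
    sum-nonEmptyPairs-glue : ∀ x b w I (f : Pair → Carrier) →
      sum f (nonEmptyPairs ((x ∷ b ∷ w) ∷ I)) ≈
      f ((x ∷ []) ∷ [] , (b ∷ w) ∷ I) ∙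
        sum (f ∘ map₁ (glue x)) (nonEmptyPairs ((b ∷ w) ∷ I))
    sum-nonEmptyPairs-glue x b w I f = begin
      sum f (nonEmptyConcatPairs (glue x I′) ++ p ∷ map (map₁ (glue x)) (nearPairs I′))
        ≡⟨ ≡.cong (λ ps → sum f (ps ++ p ∷ map (map₁ (glue x)) (nearPairs I′)))
             (nonEmptyConcatPairs-glue x I′) ⟩
      sum f (map (map₁ (glue x)) (nonEmptyConcatPairs I′) ++
             p ∷ map (map₁ (glue x)) (nearPairs I′))
        ≈⟨ sum-++ f (map _ (nonEmptyConcatPairs I′)) _ ⟩
      sum f (map (map₁ (glue x)) (nonEmptyConcatPairs I′)) ∙
        (f p ∙ sum f (map (map₁ (glue x)) (nearPairs I′)))
        ≈⟨ x∙yz≈y∙xz _ _ _ ⟩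
      f p ∙ (sum f (map (map₁ (glue x)) (nonEmptyConcatPairs I′)) ∙
             sum f (map (map₁ (glue x)) (nearPairs I′)))
        ≈⟨ ∙-congˡ (∙-cong (sum-map f _ (nonEmptyConcatPairs I′))
                           (sum-map f _ (nearPairs I′))) ⟩
      f p ∙ (sum (f ∘ map₁ (glue x)) (nonEmptyConcatPairs I′) ∙
             sum (f ∘ map₁ (glue x)) (nearPairs I′))
        ≈⟨ ∙-congˡ (sum-++ _ (nonEmptyConcatPairs I′) (nearPairs I′)) ⟨
      f p ∙ sum (f ∘ map₁ (glue x)) (nonEmptyPairs I′) ∎
      where
      I′ = (b ∷ w) ∷ I
      p  = ((x ∷ []) ∷ [] , I′)

    -- The word `[x]` cannot be cut. Removing it may leave an empty first component, so the
    -- statement for all pairs of `I` is needed.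
    nonEmptyDecompositionSums-single∷ : ∀ x I → DecompositionSums I →
      NonEmptyDecompositionSums ((x ∷ []) ∷ I)
    nonEmptyDecompositionSums-single∷ x I ih g = begin
      sum (sum g ∘ nonEmptyConcatPairs) (map ((x ∷ []) ∷_) (refinementList I))
        ≈⟨ sum-map _ _ (refinementList I) ⟩
      sum (λ J → sum g (map x∷ (concatPairs J))) (refinementList I)
        ≈⟨ sum-cong (refinementList I) (λ {J} _ → sum-map g x∷ (concatPairs J)) ⟩
      sum (sum (g ∘ x∷) ∘ concatPairs) (refinementList I)
        ≈⟨ ih (g ∘ x∷) ⟩
      sum (refinementSum (g ∘ x∷)) (concatPairs I ++ nearPairs I)
        ≈⟨ sum-cong (concatPairs I ++ nearPairs I) (λ {p} _ → refinementSum-single∷ x g p) ⟨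
      sum (refinementSum g ∘ x∷) (concatPairs I ++ nearPairs I)
        ≈⟨ sum-map _ x∷ (concatPairs I ++ nearPairs I) ⟨
      sum (refinementSum g) (map x∷ (concatPairs I ++ nearPairs I))
        ≡⟨ ≡.cong (sum (refinementSum g)) (map-++ x∷ (concatPairs I) (nearPairs I)) ⟩
      sum (refinementSum g) (nonEmptyPairs ((x ∷ []) ∷ I)) ∎
      where x∷ = map₁ ((x ∷ []) ∷_)

    nonEmptyDecompositionSums-glue : ∀ x b w I →
      NonEmptyDecompositionSums ((b ∷ w) ∷ I) →
      NonEmptyDecompositionSums ((x ∷ b ∷ w) ∷ I)
    nonEmptyDecompositionSums-glue x b w I ih g = begin
      sum (sum g ∘ nonEmptyConcatPairs) (refinementList (glue x I′))
        ≈⟨ sum-refinementList-glue x _ {I′} (λ ()) ⟩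
      sum (λ J → sum g (map x∷ (concatPairs J))) Rs ∙
        sum (sum g ∘ nonEmptyConcatPairs ∘ glue x) Rs
        ≈⟨ ∙-cong
             (sum-cong Rs λ {J} _ → sum-map g x∷ (concatPairs J))
             (sum-cong Rs λ {J} _ → trans
               (≈-reflexive (≡.cong (sum g) (nonEmptyConcatPairs-glue x J)))
               (sum-map g gx (nonEmptyConcatPairs J))) ⟩
      sum (sum (g ∘ x∷) ∘ concatPairs) Rs ∙ sum (sum (g ∘ gx) ∘ nonEmptyConcatPairs) Rs
        -- The cuts right after the separate word `[x]` are isolated; they will match the
        -- near-concatenation pair `([x] , I′)`.
        ≈⟨ ∙-congʳ (sum-concatPairs (g ∘ x∷) Rs) ⟩
      (sum (λ J → g ((x ∷ []) ∷ [] , J)) Rs ∙ sum (sum (g ∘ x∷) ∘ nonEmptyConcatPairs) Rs) ∙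
        sum (sum (g ∘ gx) ∘ nonEmptyConcatPairs) Rs
        ≈⟨ assoc _ _ _ ⟩
      sum (λ J → g ((x ∷ []) ∷ [] , J)) Rs ∙
        (sum (sum (g ∘ x∷) ∘ nonEmptyConcatPairs) Rs ∙
         sum (sum (g ∘ gx) ∘ nonEmptyConcatPairs) Rs)
        -- The sentence `[x]` has only itself as a refinement. The hypothesis is used twice, for `x`
        -- as a new word and as a new letter.
        ≈⟨ ∙-cong (sym (identityʳ _)) (∙-cong (ih (g ∘ x∷)) (ih (g ∘ gx))) ⟩
      refinementSum g ((x ∷ []) ∷ [] , I′) ∙
        (sum (refinementSum (g ∘ x∷)) (nonEmptyPairs I′) ∙
         sum (refinementSum (g ∘ gx)) (nonEmptyPairs I′))
        ≈⟨ ∙-congˡ (sum-∙ _ _ (nonEmptyPairs I′)) ⟨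
      refinementSum g ((x ∷ []) ∷ [] , I′) ∙
        sum (λ p → refinementSum (g ∘ x∷) p ∙ refinementSum (g ∘ gx) p) (nonEmptyPairs I′)
        ≈⟨ ∙-congˡ (sum-cong (nonEmptyPairs I′) λ p∈ →
             sum-refinementList-glue x _ (nonEmptyPairs-nonEmpty I′ p∈)) ⟨
      refinementSum g ((x ∷ []) ∷ [] , I′) ∙ sum (refinementSum g ∘ gx) (nonEmptyPairs I′)
        ≈⟨ sum-nonEmptyPairs-glue x b w I (refinementSum g) ⟨
      sum (refinementSum g) (nonEmptyPairs (glue x I′)) ∎
      where
      I′ = (b ∷ w) ∷ I
      Rs = refinementList I′
      x∷ = map₁ ((x ∷ []) ∷_)
      gx = map₁ (glue x)

    -- The inner recursion shortens the first word to one letter; the outer one then passes to the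
    -- remaining sentence.
    nonEmptyDecompositionSums : ∀ I → NonEmptyDecompositionSums I
    nonEmptyDecompositionSums []            g = identityˡ ε
    nonEmptyDecompositionSums ((x ∷ w) ∷ I) = go x w
      where
      go : ∀ x w → NonEmptyDecompositionSums ((x ∷ w) ∷ I)
      go x []      = nonEmptyDecompositionSums-single∷ x I
                       (decompositionSums I (nonEmptyDecompositionSums I))
      go x (b ∷ w) = nonEmptyDecompositionSums-glue x b w I (go b w)

-- Linearity and bilinearity on finite sums.

module _ {c ℓ} {R : CommutativeRing c ℓ} where

  linearExtension-sum : ∀ {x m ℓm y} {X : Set x} {Y : Set y} (N : Module R m ℓm) →
    let module N = Module N
        module Σᶠ = Summation (Module.+ᴹ-commutativeMonoid (Free R X))
        module Σᴺ = Summation N.+ᴹ-commutativeMonoid in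
    ∀ (f : X → N.Carrierᴹ) (h : Y → Term R X) ys →
    linearExtension R N f (Σᶠ.sum h ys) N.≈ᴹ Σᴺ.sum (linearExtension R N f ∘ h) ys
  linearExtension-sum N f h []       = Module.≈ᴹ-refl N
  linearExtension-sum N f h (y ∷ ys) =
    Module.+ᴹ-congˡ N (linearExtension-sum N f h ys)

  module _ {m₁ ℓm₁ m₂ ℓm₂} (V : Module R m₁ ℓm₁) (W : Module R m₂ ℓm₂) where

    private
      module R = CommutativeRing R
      module V = Module V
      module W = Module W
      module T = Module (TensorProduct R V W)
      module ΣV = Summation V.+ᴹ-commutativeMonoid
      module ΣW = Summation W.+ᴹ-commutativeMonoid
      module ΣT = Summation T.+ᴹ-commutativeMonoid

    -- Zero is written as the scalar 0 times zero, and the scalar is moved out by `*-⊗`.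
    ⊗-zeroˡ : ∀ w → gen (V.0ᴹ , w) T.≈ᴹ T.0ᴹ
    ⊗-zeroˡ w = T.≈ᴹ-trans
      (relation (⊗-cong (V.≈ᴹ-sym (V.*ₗ-zeroˡ V.0ᴹ)) W.≈ᴹ-refl))
      (T.≈ᴹ-trans (relation (*-⊗ R.0# V.0ᴹ w)) (T.*ₗ-zeroˡ _))

    ⊗-zeroʳ : ∀ v → gen (v , W.0ᴹ) T.≈ᴹ T.0ᴹ
    ⊗-zeroʳ v = T.≈ᴹ-trans
      (relation (⊗-cong V.≈ᴹ-refl (W.≈ᴹ-sym (W.*ₗ-zeroˡ W.0ᴹ))))
      (T.≈ᴹ-trans (relation (⊗-* R.0# v W.0ᴹ)) (T.*ₗ-zeroˡ _))

    ⊗-distribˡ-sum : ∀ {y} {Y : Set y} v (g : Y → W.Carrierᴹ) ys →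
      gen (v , ΣW.sum g ys) T.≈ᴹ ΣT.sum (λ y → gen (v , g y)) ys
    ⊗-distribˡ-sum v g []       = ⊗-zeroʳ v
    ⊗-distribˡ-sum v g (y ∷ ys) = T.≈ᴹ-trans
      (relation (⊗-+ v (g y) _)) (T.+ᴹ-congˡ (⊗-distribˡ-sum v g ys))

    sum-⊗-sum : ∀ {x y} {X : Set x} {Y : Set y}
      (f : X → V.Carrierᴹ) (g : Y → W.Carrierᴹ) xs ys →
      gen (ΣV.sum f xs , ΣW.sum g ys) T.≈ᴹ
      ΣT.sum (λ x → ΣT.sum (λ y → gen (f x , g y)) ys) xs
    sum-⊗-sum f g []       ys = ⊗-zeroˡ _
    sum-⊗-sum f g (x ∷ xs) ys = T.≈ᴹ-trans
      (relation (+-⊗ (f x) _ _))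
      (T.+ᴹ-cong (⊗-distribˡ-sum (f x) g ys) (sum-⊗-sum f g xs ys))

proposition5p1 : ∀ {c ℓ₁ ℓ₂ a} (𝕜 : HeytingField c ℓ₁ ℓ₂) → CharacteristicZero 𝕜 →
    (A : Set a) → Finite A → (I : Sentence A) →
    let open ColouredQSym 𝕜 A in
    δ (F I) ≈ ∑ QSym⊗QSym (concatenation-or-near I) (λ (K′ , K″) → F K′ ⊗ F K″)
proposition5p1 𝕜 _ A _ I = begin
  δ (F I)
    ≈⟨ linearExtension-sum QSym⊗QSym _ M (refinementList I) ⟩
  sum (sum M⊗M ∘ concatPairs) (refinementList I)
    ≈⟨ decompositionSums I (nonEmptyDecompositionSums I) M⊗M ⟩
  sum (refinementSum M⊗M) (concatPairs I ++ nearPairs I)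
    -- Bilinearity collects each double sum over refinements into `F K ⊗ F L`.
    ≈⟨ sum-cong (concatPairs I ++ nearPairs I) (λ { {K , L} _ →
         sum-⊗-sum QSym QSym M M (refinementList K) (refinementList L) }) ⟨
  sum (λ (K , L) → F K ⊗ F L) (concatPairs I ++ nearPairs I) ∎
  where
  open ColouredQSym 𝕜 A
  open Module QSym⊗QSym using (+ᴹ-commutativeMonoid; ≈ᴹ-setoid)
  open Summation +ᴹ-commutativeMonoid
  open SetoidReasoning ≈ᴹ-setoid

  M⊗M : Sentence A × Sentence A → Module.Carrierᴹ QSym⊗QSym
  M⊗M (J , K) = M J ⊗ M K
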